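{- Let $G=(V,E)$ be a finite undirected loopless graph (parallel edges allowed) that has a strongly connected orientation. A strongly connected orientation $D$ of $G$ is decreasingly minimal (among strongly connected orientations of $G$) if and only if there are no nodes $s,t$ with $\varrho_D(t)\ge\varrho_D(s)+2$ such that $D$ contains two arc-disjoint directed paths from $s$ to $t$.
   Context: $\varrho_D(v)$ is the in-degree of $v$ in $D$. An orientation is decreasingly minimal among a family of orientations if its in-degree vector, sorted in decreasing order, is lexicographically smaller than or equal to that of every member of the family sorted likewise. -}

module Defs where

open import Data.Nat using (ℕ; zero; suc; _+_; _≤_)
open import Data.Nat.Properties using (≤-decTotalOrder)
open import Data.Fin using (Fin)
open import Data.Bool using (Bool; true; false)
open import Data.Product using (_×_; _,_; proj₁; proj₂; Σ; ∃; ∃-syntax)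
open import Data.List using (List; []; _∷_; map; reverse; allFin)
open import Data.List.Membership.Propositional using (_∈_)
open import Data.List.Relation.Unary.Unique.Propositional using (Unique)
open import Data.List.Relation.Binary.Lex.NonStrict using (Lex-≤)
open import Relation.Binary.PropositionalEquality using (_≡_; _≢_)
open import Relation.Nullary using (¬_; Dec; yes; no)
import Data.List.Sort
import Data.Fin.Properties as FinP

-- A finite undirected loopless multigraph on node set Fin n with m edges
-- (edges are indexed by Fin m, so parallel edges are allowed).
record Graph : Set where
  field
    n     : ℕ
    m     : ℕ
    ends  : Fin m → Fin n × Fin n
    loopless : ∀ e → proj₁ (ends e) ≢ proj₂ (ends e)
open Graph public

-- An orientation: for each edge e with ends (u , v), true means u → v,
-- false means v → u.
Orientation : Graph → Set
Orientation G = Fin (m G) → Bool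

module _ (G : Graph) (D : Orientation G) where
  tail : Fin (m G) → Fin (n G)
  tail e with D e
  ... | true  = proj₁ (ends G e)
  ... | false = proj₂ (ends G e)

  head : Fin (m G) → Fin (n G)
  head e with D e
  ... | true  = proj₂ (ends G e)
  ... | false = proj₁ (ends G e)

  countHeads : Fin (n G) → List (Fin (m G)) → ℕ
  countHeads v [] = 0
  countHeads v (e ∷ es) with head e Data.Fin.≟ v
  ... | yes _ = suc (countHeads v es)
  ... | no  _ = countHeads v es

  indeg : Fin (n G) → ℕ
  indeg v = countHeads v (allFin (m G))

  data Walk : Fin (n G) → Fin (n G) → List (Fin (m G)) → Set where
    nil  : ∀ {s} → Walk s s []
    cons : ∀ {s t es} (e : Fin (m G)) → tail e ≡ s →
           Walk (head e) t es → Walk s t (e ∷ es)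

  nodes : ∀ {s t es} → Walk s t es → List (Fin (n G))
  nodes {s} nil = s ∷ []
  nodes {s} (cons e _ w) = s ∷ nodes w

  Path : Fin (n G) → Fin (n G) → List (Fin (m G)) → Set
  Path s t es = Σ (Walk s t es) (λ w → Unique (nodes w))

  StronglyConnected : Set
  StronglyConnected = ∀ s t → ∃[ es ] Path s t es

  sortedIndeg : List ℕ
  sortedIndeg = reverse (Data.List.Sort.sort ≤-decTotalOrder (map indeg (allFin (n G))))

  TwoArcDisjointPaths : Fin (n G) → Fin (n G) → Set
  TwoArcDisjointPaths s t =
    ∃[ es₁ ] ∃[ es₂ ] (Path s t es₁ × Path s t es₂ ×
      (∀ e → e ∈ es₁ → ¬ (e ∈ es₂)))

_≤lex_ : List ℕ → List ℕ → Set
_≤lex_ = Lex-≤ _≡_ _≤_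

DecMinSC : (G : Graph) → Orientation G → Set
DecMinSC G D = ∀ (D' : Orientation G) → StronglyConnected G D' →
  sortedIndeg G D ≤lex sortedIndeg G D'

{-# OPTIONS --safe #-}
-- Moving one unit of in-degree from t to s along one of two arc-disjoint s-t paths
-- keeps the orientation strong, and makes the sorted in-degree vector smaller when
-- ϱ(t) ≥ ϱ(s) + 2.
--
-- Conversely, let D be strong without such a pair, and let D′ be strong.  Write x, y
-- for the in-degree vectors.  If x(t) > y(t), there is a node s with x(s) < y(s) such
-- that D has two arc-disjoint s-t paths and D′ has two arc-disjoint t-s paths.  By the
-- hypothesis y(t) < x(t) ≤ x(s) + 1 ≤ y(s), so reversing a t-s path of D′ brings y
-- closer to x and does not raise any of the sums Σ (y(v) - c)⁺.  Iterating, the sums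
-- of x are at most those of y, which yields the lexicographic comparison.
--
-- To find s, group the nodes without two arc-disjoint paths to t in D by the last arc
-- common to all their walks to t; each class Z is left by one arc of D.  Dually, the
-- nodes without two arc-disjoint paths from t in D′ form classes W, each entered by one
-- arc of D′.  After discarding redundant classes, each Z has a node outside all W and
-- vice versa; strong connectivity of D′ and D provides an arc leaving Z ∖ ⋃W in D′ and
-- one entering W ∖ ⋃Z in D.  Comparing these counts arc by arc gives x(C) ≤ y(C) for
-- the set C ∋ t of nodes in no class, so some s ∈ C has x(s) < y(s).
module Submission where

open import Defs
open import Data.Bool using (Bool; true; false; not; if_then_else_)
import Data.Bool.Properties as Bool
open import Data.Fin using (Fin; zero; suc; _≟_)
open import Data.Fin.Properties using (all?; any?)
open import Data.List using (List; []; _∷_; _++_; map; length; reverse; tabulate; allFin)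
open import Data.List.Properties using (map-tabulate; length-map; length-tabulate; unfold-reverse)
open import Data.List.Membership.Propositional using (_∈_; _∉_)
open import Data.List.Relation.Binary.Lex.NonStrict using (base; this; next; ≤-antisymmetric)
open import Data.List.Relation.Binary.Permutation.Propositional using (_↭_; ↭-trans; ↭-sym)
import Data.List.Relation.Binary.Permutation.Propositional.Properties as Perm
open import Data.List.Relation.Binary.Pointwise using (Pointwise-≡⇒≡)
open import Data.List.Relation.Unary.All as All using (All; []; _∷_)
import Data.List.Relation.Unary.All.Properties as Allₚ
open import Data.List.Relation.Unary.AllPairs using (AllPairs; []; _∷_)
import Data.List.Relation.Unary.AllPairs.Properties as AllPairsₚ
open import Data.List.Relation.Unary.Any as Any using (Any; here; there)
open import Data.List.Relation.Unary.Linked.Properties using (Linked⇒AllPairs)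
open import Data.List.Relation.Unary.Unique.Propositional using (Unique)
open import Data.Maybe using (Maybe; just; nothing)
open import Data.Maybe.Properties using (≡-dec; just-injective)
open import Data.Nat using (ℕ; zero; suc; _+_; _*_; _∸_; _≤_; _<_; _≥_; z≤n; s≤s; s≤s⁻¹)
open import Data.Nat.ListAction using () renaming (sum to sumL)
open import Data.Nat.ListAction.Properties using (sum-↭)
open import Data.Nat.Properties hiding (_≟_)
open import Data.Nat.Tactic.RingSolver using (solve-∀)
open import Data.Product using (_×_; _,_; proj₁; proj₂; ∃; ∃-syntax; Σ-syntax)
open import Data.Sum using (_⊎_; inj₁; inj₂)
open import Data.Unit using (tt)
open import Function using (_∘_; id)
open import Function.Bundles using (_⇔_; mk⇔)
open import Level using (0ℓ)
open import Relation.Binary.Definitions using (tri<; tri≈; tri>)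
open import Relation.Binary.PropositionalEquality using (_≡_; _≢_; refl; sym; trans; cong; cong₂; subst; subst₂; ≢-sym; module ≡-Reasoning)
open import Relation.Nullary using (¬_; Dec; yes; no; contradiction; does)
open import Relation.Nullary.Decidable using (_×-dec_; ¬?; map′)
open import Relation.Unary using (Pred; Decidable; U)
open import Relation.Unary.Properties using (U?)
open import Algebra.Properties.CommutativeMonoid.Sum +-0-commutativeMonoid using (sum; sum-cong-≗; ∑-distrib-+; ∑-comm; sum-replicate-zero)
open import Algebra.Properties.CommutativeSemigroup +-commutativeSemigroup using (xy∙z≈xz∙y)
import Data.List.Membership.DecPropositional as DecMembership
open import Data.List.Sort ≤-decTotalOrder using (sort-↭; sort-↗)

-- Indicators and finite sums.

𝟙 : ∀ {a} {A : Set a} → Dec A → ℕ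
𝟙 (yes _) = 1
𝟙 (no _)  = 0

module _ {a} {A : Set a} where

  𝟙-yes : (a? : Dec A) → A → 𝟙 a? ≡ 1
  𝟙-yes (yes _) _ = refl
  𝟙-yes (no ¬a) a = contradiction a ¬a

  𝟙-no : (a? : Dec A) → ¬ A → 𝟙 a? ≡ 0
  𝟙-no (yes a) ¬a = contradiction a ¬a
  𝟙-no (no _)  _  = refl

𝟙-mono : ∀ {a b} {A : Set a} {B : Set b} (a? : Dec A) (b? : Dec B) → (A → B) → 𝟙 a? ≤ 𝟙 b?
𝟙-mono (yes a) b? f = ≤-reflexive (sym (𝟙-yes b? (f a)))
𝟙-mono (no _)  b? f = z≤n

𝟙-cong : ∀ {a b} {A : Set a} {B : Set b} (a? : Dec A) (b? : Dec B) → (A → B) → (B → A) → 𝟙 a? ≡ 𝟙 b?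
𝟙-cong a? b? f g = ≤-antisym (𝟙-mono a? b? f) (𝟙-mono b? a? g)

sum-mono-≤ : ∀ {k} {f g : Fin k → ℕ} → (∀ i → f i ≤ g i) → sum f ≤ sum g
sum-mono-≤ {zero}  f≤g = z≤n
sum-mono-≤ {suc k} f≤g = +-mono-≤ (f≤g zero) (sum-mono-≤ (f≤g ∘ suc))

sum-mono-< : ∀ {k} {f g : Fin k → ℕ} → (∀ i → f i ≤ g i) → ∀ j → f j < g j → sum f < sum g
sum-mono-< f≤g zero    f<g = +-mono-<-≤ f<g (sum-mono-≤ (f≤g ∘ suc))
sum-mono-< f≤g (suc j) f<g = +-mono-≤-< (f≤g zero) (sum-mono-< (f≤g ∘ suc) j f<g)

term≤sum : ∀ {k} (f : Fin k → ℕ) i → f i ≤ sum f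
term≤sum f zero    = m≤m+n _ _
term≤sum f (suc i) = ≤-trans (term≤sum (f ∘ suc) i) (m≤n+m _ _)

sum-δ : ∀ {k} (i : Fin k) (f : Fin k → ℕ) → sum (λ j → 𝟙 (i ≟ j) * f j) ≡ f i
sum-δ {suc k} zero f = begin
  f zero + 0 + sum {k} (λ _ → 0)  ≡⟨ cong₂ _+_ (+-identityʳ _) (sum-replicate-zero k) ⟩
  f zero + 0                  ≡⟨ +-identityʳ _ ⟩
  f zero                      ∎
  where open ≡-Reasoning
sum-δ (suc i) f = trans (sum-cong-≗ λ j → cong (_* f (suc j)) (𝟙-cong (suc i ≟ suc j) (i ≟ j) (λ { refl → refl }) (cong suc))) (sum-δ i (f ∘ suc))

-- Sums of excesses, lexicographic comparison, and transfers of one unit.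

excess : ℕ → List ℕ → ℕ
excess c xs = sumL (map (_∸ c) xs)

excess-below : ∀ {c xs} → All (_≤ c) xs → excess c xs ≡ 0
excess-below []         = refl
excess-below (x≤c ∷ ps) = cong₂ _+_ (m≤n⇒m∸n≡0 x≤c) (excess-below ps)

Descending : List ℕ → Set
Descending = AllPairs _≥_

-- Equal heads contribute equally at every level and cancel. A head `x > y` is impossible: at level
-- `c = y` the left side is positive, while every entry of the descending right list is at most `y`.
excess≤⇒≤lex : ∀ {xs ys} → Descending xs → Descending ys → length xs ≡ length ys →
               (∀ c → excess c xs ≤ excess c ys) → xs ≤lex ys
excess≤⇒≤lex {[]}     {[]}     _ _ _ _ = base tt
excess≤⇒≤lex {x ∷ xs} {y ∷ ys} (_ ∷ xs↘) (y≥ ∷ ys↘) |xs|≡|ys| h with <-cmp x y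
... | tri< x<y x≢y _ = this (<⇒≤ x<y , x≢y)
... | tri≈ _ refl _ = next refl (excess≤⇒≤lex xs↘ ys↘ (suc-injective |xs|≡|ys|)
        λ c → +-cancelˡ-≤ (x ∸ c) _ _ (h c))
... | tri> _ _ y<x = contradiction (m<n⇒0<n∸m y<x)
        (≤⇒≯ (≤-trans (≤-trans (m≤m+n _ _) (h y)) (≤-reflexive (excess-below (≤-refl ∷ y≥)))))

reverse-descending : ∀ {xs} → AllPairs _≤_ xs → Descending (reverse xs)
reverse-descending [] = []
reverse-descending {x ∷ xs} (x≤ ∷ xs↗) rewrite unfold-reverse x xs =
  AllPairsₚ.++⁺ (reverse-descending xs↗) ([] ∷ [])
    (All.map (_∷ []) (Perm.All-resp-↭ (↭-sym (Perm.↭-reverse xs)) x≤))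

sumL-tabulate : ∀ {k} (f : Fin k → ℕ) → sumL (tabulate f) ≡ sum f
sumL-tabulate {zero}  f = refl
sumL-tabulate {suc k} f = cong (f zero +_) (sumL-tabulate (f ∘ suc))

step-∸ : ∀ k c → suc k ∸ c ≡ (k ∸ c) + 𝟙 (c ≤? k)
step-∸ k c with c ≤? k
... | yes c≤k = trans (+-∸-assoc 1 c≤k) (+-comm 1 (k ∸ c))
... | no  c≰k = trans (m≤n⇒m∸n≡0 (≰⇒> c≰k)) (sym (trans (+-identityʳ _) (m≤n⇒m∸n≡0 (<⇒≤ (≰⇒> c≰k)))))

-- g arises from f by moving one unit from t to s, so it suffices to compare
-- the increments of k ↦ k ∸ c at f s and at g t.
module Transfer {k} (f g : Fin k → ℕ) {s t : Fin k} (s≢t : s ≢ t)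
  (g≡ : ∀ v → g v + 𝟙 (t ≟ v) ≡ f v + 𝟙 (s ≟ v)) where

  transfer-s : g s ≡ suc (f s)
  transfer-s = begin
    g s                 ≡⟨ +-identityʳ _ ⟨
    g s + 0             ≡⟨ cong (g s +_) (𝟙-no (t ≟ s) (s≢t ∘ sym)) ⟨
    g s + 𝟙 (t ≟ s)     ≡⟨ g≡ s ⟩
    f s + 𝟙 (s ≟ s)     ≡⟨ cong (f s +_) (𝟙-yes (s ≟ s) refl) ⟩
    f s + 1             ≡⟨ +-comm (f s) 1 ⟩
    suc (f s)           ∎
    where open ≡-Reasoning

  transfer-t : f t ≡ suc (g t)
  transfer-t = begin
    f t                 ≡⟨ +-identityʳ _ ⟨
    f t + 0             ≡⟨ cong (f t +_) (𝟙-no (s ≟ t) s≢t) ⟨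
    f t + 𝟙 (s ≟ t)     ≡⟨ g≡ t ⟨
    g t + 𝟙 (t ≟ t)     ≡⟨ cong (g t +_) (𝟙-yes (t ≟ t) refl) ⟩
    g t + 1             ≡⟨ +-comm (g t) 1 ⟩
    suc (g t)           ∎
    where open ≡-Reasoning

  transfer-other : ∀ {v} → s ≢ v → t ≢ v → g v ≡ f v
  transfer-other {v} s≢v t≢v = begin
    g v                 ≡⟨ +-identityʳ _ ⟨
    g v + 0             ≡⟨ cong (g v +_) (𝟙-no (t ≟ v) t≢v) ⟨
    g v + 𝟙 (t ≟ v)     ≡⟨ g≡ v ⟩
    f v + 𝟙 (s ≟ v)     ≡⟨ cong (f v +_) (𝟙-no (s ≟ v) s≢v) ⟩
    f v + 0             ≡⟨ +-identityʳ _ ⟩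
    f v                 ∎
    where open ≡-Reasoning

  transfer-∸ : ∀ c v → (g v ∸ c) + 𝟙 (t ≟ v) * 𝟙 (c ≤? g t) ≡ (f v ∸ c) + 𝟙 (s ≟ v) * 𝟙 (c ≤? f s)
  transfer-∸ c v with t ≟ v | s ≟ v
  ... | yes refl | yes refl = contradiction refl s≢t
  ... | yes refl | no _ rewrite transfer-t | step-∸ (g v) c =
        trans (cong ((g v ∸ c) +_) (+-identityʳ _)) (sym (+-identityʳ _))
  ... | no _ | yes refl rewrite transfer-s | step-∸ (f v) c =
        trans (+-identityʳ _) (cong ((f v ∸ c) +_) (sym (+-identityʳ _)))
  ... | no t≢v | no s≢v = cong (λ k → k ∸ c + 0) (transfer-other s≢v t≢v)

  sum-transfer-∸ : ∀ c → sum (λ v → g v ∸ c) + 𝟙 (c ≤? g t) ≡ sum (λ v → f v ∸ c) + 𝟙 (c ≤? f s)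
  sum-transfer-∸ c = begin
    sum (λ v → g v ∸ c) + 𝟙 (c ≤? g t)                                   ≡⟨ cong (sum (λ v → g v ∸ c) +_) (sum-δ t (λ _ → 𝟙 (c ≤? g t))) ⟨
    sum (λ v → g v ∸ c) + sum (λ v → 𝟙 (t ≟ v) * 𝟙 (c ≤? g t))           ≡⟨ ∑-distrib-+ (λ v → g v ∸ c) _ ⟨
    sum (λ v → (g v ∸ c) + 𝟙 (t ≟ v) * 𝟙 (c ≤? g t))                     ≡⟨ sum-cong-≗ (transfer-∸ c) ⟩
    sum (λ v → (f v ∸ c) + 𝟙 (s ≟ v) * 𝟙 (c ≤? f s))                     ≡⟨ ∑-distrib-+ (λ v → f v ∸ c) _ ⟩
    sum (λ v → f v ∸ c) + sum (λ v → 𝟙 (s ≟ v) * 𝟙 (c ≤? f s))           ≡⟨ cong (sum (λ v → f v ∸ c) +_) (sum-δ s (λ _ → 𝟙 (c ≤? f s))) ⟩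
    sum (λ v → f v ∸ c) + 𝟙 (c ≤? f s)                                   ∎
    where open ≡-Reasoning

  transfer-≤ : f s < f t → ∀ c → sum (λ v → g v ∸ c) ≤ sum (λ v → f v ∸ c)
  transfer-≤ fs<ft c = +-cancelʳ-≤ (𝟙 (c ≤? g t)) _ _ (≤-trans (≤-reflexive (sum-transfer-∸ c))
    (+-monoʳ-≤ _ (𝟙-mono (c ≤? f s) (c ≤? g t) λ c≤fs → ≤-trans c≤fs (s≤s⁻¹ (subst (f s <_) transfer-t fs<ft)))))

  -- The level `g t` detects the transfer: `t` loses its one unit above that level, while
  -- `f s < g t` keeps the unit gained by `s` from counting.
  transfer-≢ : f s + 2 ≤ f t → sum (λ v → g v ∸ g t) ≢ sum (λ v → f v ∸ g t)
  transfer-≢ fs+2≤ft eq = contradiction (+-cancelˡ-≡ (sum (λ v → f v ∸ g t)) _ _ (trans (cong (_+ 1) (sym eq)) (begin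
    sum (λ v → g v ∸ g t) + 1                  ≡⟨ cong (sum (λ v → g v ∸ g t) +_) (𝟙-yes (g t ≤? g t) ≤-refl) ⟨
    sum (λ v → g v ∸ g t) + 𝟙 (g t ≤? g t)     ≡⟨ sum-transfer-∸ (g t) ⟩
    sum (λ v → f v ∸ g t) + 𝟙 (g t ≤? f s)     ≡⟨ cong (sum (λ v → f v ∸ g t) +_) (𝟙-no (g t ≤? f s) (<⇒≱ fs<gt)) ⟩
    sum (λ v → f v ∸ g t) + 0                  ∎))) λ ()
    where
    open ≡-Reasoning
    fs<gt : f s < g t
    fs<gt = s≤s⁻¹ (subst₂ _≤_ (+-comm (f s) 2) transfer-t fs+2≤ft)

-- Families of disjoint node classes, encoded as labellings.

Label : ℕ → Set
Label k = Maybe (Fin k)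

module _ {k : ℕ} where

  _≟ᴸ_ : (x y : Label k) → Dec (x ≡ y)
  _≟ᴸ_ = ≡-dec _≟_

  -- For an arc with tail labelled `x` and head labelled `y`, `leaves x y` tells whether it leaves
  -- the class of its tail; `nothing` marks nodes in no class.
  leaves : Label k → Label k → ℕ
  leaves nothing  _        = 0
  leaves (just _) nothing  = 1
  leaves (just a) (just b) = 𝟙 (¬? (a ≟ b))

  leaves-≢ : ∀ {x y a} → x ≡ just a → y ≢ just a → 1 ≤ leaves x y
  leaves-≢ {y = nothing} refl _   = ≤-refl
  leaves-≢ {y = just b} {a} refl neq = ≤-reflexive (sym (𝟙-yes (¬? (a ≟ b)) λ { refl → neq refl }))

  -- The first argument is the label in the other family, so `pure (w v) (z v)` describes the parts
  -- of the classes of `z` outside those of `w`.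
  pure : Label k → Label k → Label k
  pure nothing  x = x
  pure (just _) _ = nothing

  free? : (x y : Label k) → Dec (x ≡ nothing × y ≡ nothing)
  free? nothing  nothing  = yes (refl , refl)
  free? nothing  (just _) = no λ ()
  free? (just _) _        = no λ ()

  -- In the next two lemmas p → q is an arc of D, which D′ keeps or reverses; z and w
  -- name the classes of its ends.
  uncross-same : ∀ zp zq wp wq →
    𝟙 (free? zq wq) + (leaves (pure wp zp) (pure wq zq) + leaves (pure zq wq) (pure zp wp)) ≤
    𝟙 (free? zq wq) + (leaves zp zq + leaves wq wp)
  uncross-same zp zq wp wq = +-monoʳ-≤ (𝟙 (free? zq wq)) (go zp zq wp wq)
    where
    go : ∀ zp zq wp wq → leaves (pure wp zp) (pure wq zq) + leaves (pure zq wq) (pure zp wp) ≤ leaves zp zq + leaves wq wp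
    go nothing  nothing  nothing  nothing  = z≤n
    go nothing  nothing  nothing  (just _) = ≤-refl
    go nothing  nothing  (just _) nothing  = z≤n
    go nothing  nothing  (just _) (just _) = ≤-refl
    go nothing  (just _) nothing  nothing  = z≤n
    go nothing  (just _) nothing  (just _) = z≤n
    go nothing  (just _) (just _) nothing  = z≤n
    go nothing  (just _) (just _) (just _) = z≤n
    go (just _) nothing  nothing  nothing  = ≤-refl
    go (just _) nothing  nothing  (just _) = ≤-refl
    go (just _) nothing  (just _) nothing  = z≤n
    go (just _) nothing  (just _) (just _) = s≤s z≤n
    go (just _) (just _) nothing  nothing  = ≤-refl
    go (just _) (just _) nothing  (just _) = m≤n+m 1 _
    go (just _) (just _) (just _) nothing  = z≤n
    go (just _) (just _) (just _) (just _) = z≤n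

  uncross-opp : ∀ zp zq wp wq →
    𝟙 (free? zq wq) + (leaves (pure wq zq) (pure wp zp) + leaves (pure zq wq) (pure zp wp)) ≤
    𝟙 (free? zp wp) + (leaves zp zq + leaves wp wq)
  uncross-opp nothing  nothing  nothing  nothing  = ≤-refl
  uncross-opp nothing  nothing  nothing  (just _) = ≤-refl
  uncross-opp nothing  nothing  (just _) nothing  = ≤-refl
  uncross-opp nothing  nothing  (just b) (just c) = 𝟙-mono (¬? (c ≟ b)) (¬? (b ≟ c)) ≢-sym
  uncross-opp nothing  (just _) nothing  nothing  = ≤-refl
  uncross-opp nothing  (just _) nothing  (just _) = z≤n
  uncross-opp nothing  (just _) (just _) nothing  = ≤-refl
  uncross-opp nothing  (just _) (just _) (just _) = z≤n
  uncross-opp (just _) nothing  nothing  nothing  = ≤-refl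
  uncross-opp (just _) nothing  nothing  (just _) = ≤-refl
  uncross-opp (just _) nothing  (just _) nothing  = s≤s z≤n
  uncross-opp (just _) nothing  (just _) (just _) = s≤s z≤n
  uncross-opp (just b) (just c) nothing  nothing  = +-monoˡ-≤ 0 (𝟙-mono (¬? (c ≟ b)) (¬? (b ≟ c)) ≢-sym)
  uncross-opp (just _) (just _) nothing  (just _) = z≤n
  uncross-opp (just _) (just _) (just _) nothing  = m≤n+m 1 _
  uncross-opp (just _) (just _) (just _) (just _) = z≤n



module _ {k l : ℕ} where

  -- A class survives if some node of it lies in no class of `w`. It is then kept whole, which
  -- preserves the arcs leaving it.
  prune : (z w : Fin l → Label k) → Fin l → Label k
  prune z w v = keep (z v)
    where
    keep : Label k → Label k
    keep nothing  = nothing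
    keep (just a) with any? (λ u → (z u ≟ᴸ just a) ×-dec (w u ≟ᴸ nothing))
    ... | yes _ = just a
    ... | no _  = nothing

  module _ (z w : Fin l → Label k) where

    prune-just⁻ : ∀ {v a} → prune z w v ≡ just a → z v ≡ just a × ∃[ u ] (z u ≡ just a × w u ≡ nothing)
    prune-just⁻ {v} eq with z v
    ... | just b with any? (λ u → (z u ≟ᴸ just b) ×-dec (w u ≟ᴸ nothing)) | eq
    ...   | yes p | refl = refl , p

    prune-just⁺ : ∀ {v u a} → z v ≡ just a → z u ≡ just a → w u ≡ nothing → prune z w v ≡ just a
    prune-just⁺ {v} {u} {a} zv zu wu rewrite zv with any? (λ u → (z u ≟ᴸ just a) ×-dec (w u ≟ᴸ nothing))
    ... | yes _ = refl
    ... | no ¬p = contradiction (u , zu , wu) ¬p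

    prune-nothing⁺ : ∀ {v} → z v ≡ nothing → prune z w v ≡ nothing
    prune-nothing⁺ zv rewrite zv = refl

    -- A labelled node outside the classes of `w` is itself a witness that its class survives.
    prune-nothing⁻ : ∀ {v} → prune z w v ≡ nothing → w v ≡ nothing → z v ≡ nothing
    prune-nothing⁻ {v} eq wv = go (z v) refl
      where
      go : ∀ x → z v ≡ x → z v ≡ nothing
      go nothing  zv = zv
      go (just a) zv = contradiction (trans (sym (prune-just⁺ zv zv wv)) eq) λ ()

module _ (G : Graph) where

  private
    Node = Fin (n G)
    Arc  = Fin (m G)

  open DecMembership (_≟_ {n G}) using () renaming (_∈?_ to _∈ⁿ?_)
  open DecMembership (_≟_ {m G}) using (_∈?_)

  -- Sorted in-degree vectors.

  sortedIndeg-↭ : ∀ D → sortedIndeg G D ↭ map (indeg G D) (allFin (n G))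
  sortedIndeg-↭ D = ↭-trans (Perm.↭-reverse _) (sort-↭ _)

  sortedIndeg-descending : ∀ D → Descending (sortedIndeg G D)
  sortedIndeg-descending D = reverse-descending (Linked⇒AllPairs ≤-trans (sort-↗ (map (indeg G D) (allFin (n G)))))

  length-sortedIndeg : ∀ D → length (sortedIndeg G D) ≡ n G
  length-sortedIndeg D = trans (Perm.↭-length (sortedIndeg-↭ D))
    (trans (length-map (indeg G D) (allFin (n G))) (length-tabulate id))

  excess-sortedIndeg : ∀ D c → excess c (sortedIndeg G D) ≡ sum (λ v → indeg G D v ∸ c)
  excess-sortedIndeg D c = begin
    sumL (map (_∸ c) (sortedIndeg G D))                    ≡⟨ sum-↭ (Perm.map⁺ (_∸ c) (sortedIndeg-↭ D)) ⟩
    sumL (map (_∸ c) (map (indeg G D) (allFin (n G))))     ≡⟨ cong (sumL ∘ map (_∸ c)) (map-tabulate id (indeg G D)) ⟩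
    sumL (map (_∸ c) (tabulate (indeg G D)))               ≡⟨ cong sumL (map-tabulate (indeg G D) (_∸ c)) ⟩
    sumL (tabulate (λ v → indeg G D v ∸ c))                ≡⟨ sumL-tabulate (λ v → indeg G D v ∸ c) ⟩
    sum (λ v → indeg G D v ∸ c)                            ∎
    where open ≡-Reasoning

  -- This is majorization of in-degree vectors, expressed by positive parts instead of partial sums
  -- of sorted entries.
  _≼_ : Orientation G → Orientation G → Set
  D ≼ D′ = ∀ c → sum (λ v → indeg G D v ∸ c) ≤ sum (λ v → indeg G D′ v ∸ c)

  ≼⇒≤lex : ∀ {D D′} → D ≼ D′ → sortedIndeg G D ≤lex sortedIndeg G D′
  ≼⇒≤lex {D} {D′} D≼D′ = excess≤⇒≤lex (sortedIndeg-descending D) (sortedIndeg-descending D′)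
    (trans (length-sortedIndeg D) (sym (length-sortedIndeg D′)))
    λ c → subst₂ _≤_ (sym (excess-sortedIndeg D c)) (sym (excess-sortedIndeg D′ c)) (D≼D′ c)

  -- Antisymmetry of the lexicographic order makes the two sorted lists equal, and the sums depend
  -- only on these lists.
  ≼∧≥lex⇒≡ : ∀ {D D′} → D ≼ D′ → sortedIndeg G D′ ≤lex sortedIndeg G D →
             ∀ c → sum (λ v → indeg G D v ∸ c) ≡ sum (λ v → indeg G D′ v ∸ c)
  ≼∧≥lex⇒≡ {D} {D′} D≼D′ D′≤D c = begin
    sum (λ v → indeg G D v ∸ c)    ≡⟨ excess-sortedIndeg D c ⟨
    excess c (sortedIndeg G D)     ≡⟨ cong (excess c) (Pointwise-≡⇒≡ (≤-antisymmetric sym ≤-antisym (≼⇒≤lex D≼D′) D′≤D)) ⟩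
    excess c (sortedIndeg G D′)    ≡⟨ excess-sortedIndeg D′ c ⟩
    sum (λ v → indeg G D′ v ∸ c)   ∎
    where open ≡-Reasoning

  -- Arcs and walks under a change of orientation.

  tail-cong : ∀ (D D′ : Orientation G) {e} → D e ≡ D′ e → tail G D e ≡ tail G D′ e
  tail-cong D D′ {e} eq with D e | D′ e
  tail-cong D D′ {e} refl | true  | _ = refl
  tail-cong D D′ {e} refl | false | _ = refl

  head-cong : ∀ (D D′ : Orientation G) {e} → D e ≡ D′ e → head G D e ≡ head G D′ e
  head-cong D D′ {e} eq with D e | D′ e
  head-cong D D′ {e} refl | true  | _ = refl
  head-cong D D′ {e} refl | false | _ = refl

  tail-opp : ∀ (D D′ : Orientation G) {e} → D e ≢ D′ e → tail G D e ≡ head G D′ e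
  tail-opp D D′ {e} D≢D′ with D e | D′ e
  ... | true  | true  = contradiction refl D≢D′
  ... | true  | false = refl
  ... | false | true  = refl
  ... | false | false = contradiction refl D≢D′

  head-opp : ∀ (D D′ : Orientation G) {e} → D e ≢ D′ e → head G D e ≡ tail G D′ e
  head-opp D D′ D≢D′ = sym (tail-opp D′ D (≢-sym D≢D′))

  rev : Orientation G → Orientation G
  rev D = not ∘ D

  rev-opp : ∀ (D : Orientation G) {e} → D e ≢ rev D e
  rev-opp D = Bool.not-¬ refl

  walk-++ : ∀ {D s t u es fs} → Walk G D s t es → Walk G D t u fs → Walk G D s u (es ++ fs)
  walk-++ nil         w′ = w′
  walk-++ (cons e p w) w′ = cons e p (walk-++ w w′)

  -- Walks compose freely, so connectivity arguments use them, with `P` restricting the arcs; paths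
  -- are extracted only where simplicity matters.
  Reach : Orientation G → Pred Arc 0ℓ → Node → Node → Set
  Reach D P s t = ∃[ es ] (Walk G D s t es × All P es)

  reach-refl : ∀ {D P s} → Reach D P s s
  reach-refl = [] , nil , []

  reach-trans : ∀ {D P s t u} → Reach D P s t → Reach D P t u → Reach D P s u
  reach-trans (_ , w , ps) (_ , w′ , ps′) = _ , walk-++ w w′ , Allₚ.++⁺ ps ps′

  reach-arc : ∀ {D P} e → P e → Reach D P (tail G D e) (head G D e)
  reach-arc e p = _ , cons e refl nil , p ∷ []

  reach-map : ∀ {D D′ Q s t es} → Walk G D s t es →
              All (λ e → Reach D′ Q (tail G D e) (head G D e)) es → Reach D′ Q s t
  reach-map nil             []       = reach-refl
  reach-map (cons e refl w) (r ∷ rs) = reach-trans r (reach-map w rs)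

  reach-map-reverse : ∀ {D D′ Q s t es} → Walk G D s t es →
                      All (λ e → Reach D′ Q (head G D e) (tail G D e)) es → Reach D′ Q t s
  reach-map-reverse nil             []       = reach-refl
  reach-map-reverse (cons e refl w) (r ∷ rs) = reach-trans (reach-map-reverse w rs) r

  reach-same : ∀ D D′ {P e} → D e ≡ D′ e → P e → Reach D′ P (tail G D e) (head G D e)
  reach-same D D′ {P} {e} eq p =
    subst₂ (Reach D′ P) (sym (tail-cong D D′ eq)) (sym (head-cong D D′ eq)) (reach-arc e p)

  reach-opp : ∀ D D′ {P e} → D e ≢ D′ e → P e → Reach D′ P (head G D e) (tail G D e)
  reach-opp D D′ {P} {e} neq p =
    subst₂ (Reach D′ P) (sym (head-opp D D′ neq)) (sym (tail-opp D D′ neq)) (reach-arc e p)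

  reach-rev : ∀ {D P s t} → Reach (rev D) P s t → Reach D P t s
  reach-rev {D} (_ , w , ps) =
    reach-map-reverse w (All.map (λ {e} → reach-opp (rev D) D (≢-sym (rev-opp D {e}))) ps)

  -- From walks to paths.

  path-from : ∀ {D s t v es} (w : Walk G D s t es) → Unique (nodes G D w) → v ∈ nodes G D w →
              ∃[ fs ] (Path G D v t fs × (∀ e → e ∈ fs → e ∈ es))
  path-from nil          u        (here refl) = _ , (nil , u) , λ _ → id
  path-from (cons e p w) u        (here refl) = _ , (cons e p w , u) , λ _ → id
  path-from (cons e p w) (_ ∷ u)  (there v∈)  =
    let fs , path , fs⊆es = path-from w u v∈ in fs , path , λ f → there ∘ fs⊆es f

  -- If the start node recurs on the path already built for the rest, only the part from that
  -- occurrence on is kept.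
  walk⇒path : ∀ {D s t es} → Walk G D s t es →
              ∃[ fs ] (Path G D s t fs × (∀ e → e ∈ fs → e ∈ es))
  walk⇒path nil = _ , (nil , [] ∷ []) , λ _ → id
  walk⇒path {D} {s} (cons e p w) with walk⇒path w
  ... | fs , (w′ , u) , fs⊆es with s ∈ⁿ? nodes G D w′
  ...   | yes s∈ = let gs , path , gs⊆fs = path-from w′ u s∈ in
                   gs , path , λ f → there ∘ fs⊆es f ∘ gs⊆fs f
  ...   | no  s∉ = e ∷ fs , (cons e p w′ , Allₚ.¬Any⇒All¬ _ s∉ ∷ u) ,
                   λ { f (here eq) → here eq ; f (there f∈) → there (fs⊆es f f∈) }

  reach⇒path : ∀ {D P s t} → Reach D P s t → ∃[ es ] (Path G D s t es × All P es)
  reach⇒path (es , w , ps) =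
    let fs , path , fs⊆es = walk⇒path w in fs , path , All.tabulate (λ {e} e∈ → All.lookup ps (fs⊆es e e∈))

  tail∈nodes : ∀ {D s t es e} (w : Walk G D s t es) → e ∈ es → tail G D e ∈ nodes G D w
  tail∈nodes (cons e p w) (here refl) = here p
  tail∈nodes (cons e p w) (there e∈)  = there (tail∈nodes w e∈)

  -- A repeated arc would repeat its tail among the nodes.
  path-arcs-unique : ∀ {D s t es} (w : Walk G D s t es) → Unique (nodes G D w) → Unique es
  path-arcs-unique nil             _        = []
  path-arcs-unique {D} (cons e refl w) (s∉ ∷ u) =
    All.tabulate (λ f∈ → λ { refl → All.lookup s∉ (tail∈nodes w f∈) refl }) ∷ path-arcs-unique w u

  -- Decidability of reachability.

  module _ {D : Orientation G} {P : Pred Arc 0ℓ} (P? : Decidable P) (s : Node) where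

    private
      Closure : Set
      Closure = Σ[ S ∈ (Node → Bool) ] (S s ≡ true × (∀ v → S v ≡ true → Reach D P s v) ×
                 (∀ e → P e → S (tail G D e) ≡ true → S (head G D e) ≡ true))

      missing : (Node → Bool) → ℕ
      missing S = sum (λ v → 𝟙 (S v Bool.≟ false))

      insert : Node → (Node → Bool) → Node → Bool
      insert u S v = if does (u ≟ v) then true else S v

      insert-self : ∀ u S → insert u S u ≡ true
      insert-self u S with u ≟ u
      ... | yes _  = refl
      ... | no u≢u = contradiction refl u≢u

      insert-⊇ : ∀ u S {v} → S v ≡ true → insert u S v ≡ true
      insert-⊇ u S {v} v∈S with u ≟ v
      ... | yes _ = refl
      ... | no _  = v∈S

      insert-missing : ∀ u S → S u ≡ false → missing (insert u S) < missing S
      insert-missing u S u∉S = sum-mono-<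
        (λ v → 𝟙-mono (insert u S v Bool.≟ false) (S v Bool.≟ false)
          λ v∉ → Bool.¬-not λ v∈S → Bool.not-¬ (insert-⊇ u S v∈S) v∉)
        u (subst₂ _<_ (sym (𝟙-no (insert u S u Bool.≟ false) (Bool.not-¬ (insert-self u S))))
                      (sym (𝟙-yes (S u Bool.≟ false) u∉S)) (s≤s z≤n))

      -- Each round adds the head of an allowed arc leaving `S`, so the number of nodes outside `S`
      -- bounds the number of rounds.
      grow : ∀ k S → missing S ≤ k → S s ≡ true → (∀ v → S v ≡ true → Reach D P s v) → Closure
      grow k S |S|≤k s∈S sound
        with any? (λ e → P? e ×-dec (S (tail G D e) Bool.≟ true) ×-dec (S (head G D e) Bool.≟ false))
      ... | no ¬e = S , s∈S , sound , λ e p t∈S → Bool.¬-not λ h∉S → ¬e (e , p , t∈S , h∉S)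
      grow zero S |S|≤k s∈S sound | yes (e , p , t∈S , h∉S) =
        contradiction (≤-trans (insert-missing _ S h∉S) |S|≤k) λ ()
      grow (suc k) S |S|≤k s∈S sound | yes (e , p , t∈S , h∉S) =
        grow k (insert (head G D e) S) (s≤s⁻¹ (≤-trans (insert-missing _ S h∉S) |S|≤k))
          (insert-⊇ (head G D e) S s∈S) sound′
        where
        sound′ : ∀ v → insert (head G D e) S v ≡ true → Reach D P s v
        sound′ v v∈ with head G D e ≟ v
        ... | yes refl = reach-trans (sound _ t∈S) (reach-arc e p)
        ... | no _     = sound v v∈

      closure : Closure
      closure = grow (missing S₀) S₀ ≤-refl (insert-self s (λ _ → false)) sound
        where
        S₀ = insert s (λ _ → false)
        sound : ∀ v → S₀ v ≡ true → Reach D P s v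
        sound v v∈ with s ≟ v
        ... | yes refl = reach-refl

    reach? : ∀ t → Dec (Reach D P s t)
    reach? t with closure
    ... | S , s∈S , sound , closed = map′ (sound t) (λ (_ , w , ps) → follow w ps s∈S) (S t Bool.≟ true)
      where
      follow : ∀ {u v es} → Walk G D u v es → All P es → S u ≡ true → S v ≡ true
      follow nil             []       u∈S = u∈S
      follow (cons e refl w) (p ∷ ps) u∈S = follow w ps (closed e p u∈S)

  -- Reversing arcs and the effect on in-degrees.

  toggle : Orientation G → Arc → Orientation G
  toggle D e f = if does (e ≟ f) then not (D f) else D f

  infixl 5 _⊕_
  -- An arc is flipped once per occurrence in the list, so `Unique es` ensures that every listed arc
  -- ends up reversed.
  _⊕_ : Orientation G → List Arc → Orientation G
  D ⊕ []       = D
  D ⊕ (e ∷ es) = toggle (D ⊕ es) e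

  ⊕-∉ : ∀ D {es f} → f ∉ es → D f ≡ (D ⊕ es) f
  ⊕-∉ D {[]}         f∉ = refl
  ⊕-∉ D {e ∷ es} {f} f∉ with e ≟ f
  ... | yes refl = contradiction (here refl) f∉
  ... | no _     = ⊕-∉ D (f∉ ∘ there)

  ⊕-∈ : ∀ D {es f} → Unique es → f ∈ es → D f ≢ (D ⊕ es) f
  ⊕-∈ D {e ∷ es} {f} (e∉ ∷ u) f∈ with e ≟ f | f∈
  ... | yes refl | _         = Bool.not-¬ (⊕-∉ D {es} λ e∈ → All.lookup e∉ e∈ refl)
  ... | no e≢f   | here f≡e  = contradiction (sym f≡e) e≢f
  ... | no _     | there f∈′ = ⊕-∈ D u f∈′

  indeg-sum : ∀ D v → indeg G D v ≡ sum (λ e → 𝟙 (head G D e ≟ v))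
  indeg-sum D v = count id
    where
    count : ∀ {k} (f : Fin k → Arc) → countHeads G D v (tabulate f) ≡ sum (λ i → 𝟙 (head G D (f i) ≟ v))
    count {zero}  f = refl
    count {suc k} f with head G D (f zero) ≟ v
    ... | yes _ = cong suc (count (f ∘ suc))
    ... | no _  = count (f ∘ suc)

  indeg-toggle : ∀ D e v → indeg G (toggle D e) v + 𝟙 (head G D e ≟ v) ≡ indeg G D v + 𝟙 (tail G D e ≟ v)
  indeg-toggle D e v = begin
    indeg G (toggle D e) v + into D e                            ≡⟨ cong₂ _+_ (indeg-sum (toggle D e) v) (sym (sum-δ e (into D))) ⟩
    sum (into (toggle D e)) + sum (λ f → 𝟙 (e ≟ f) * into D f)   ≡⟨ ∑-distrib-+ (into (toggle D e)) _ ⟨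
    sum (λ f → into (toggle D e) f + 𝟙 (e ≟ f) * into D f)       ≡⟨ sum-cong-≗ pointwise ⟩
    sum (λ f → into D f + 𝟙 (e ≟ f) * outof f)                   ≡⟨ ∑-distrib-+ (into D) _ ⟩
    sum (into D) + sum (λ f → 𝟙 (e ≟ f) * outof f)               ≡⟨ cong₂ _+_ (sym (indeg-sum D v)) (sum-δ e outof) ⟩
    indeg G D v + outof e                                        ∎
    where
    open ≡-Reasoning
    into : Orientation G → Arc → ℕ
    into D f = 𝟙 (head G D f ≟ v)
    outof : Arc → ℕ
    outof f = 𝟙 (tail G D f ≟ v)
    swap : ∀ a b → a + 1 * b ≡ b + 1 * a
    swap = solve-∀
    split : ∀ f (e≟f : Dec (e ≡ f)) → into (toggle D e) f + 𝟙 e≟f * into D f ≡ into D f + 𝟙 e≟f * outof f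
    split f (yes refl) = trans (swap _ (into D e))
      (cong (λ h → into D e + 1 * 𝟙 (h ≟ v)) (sym (tail-opp D (toggle D e) (⊕-∈ D ([] ∷ []) (here refl)))))
    split f (no e≢f) = cong (λ h → 𝟙 (h ≟ v) + 0)
      (sym (head-cong D (toggle D e) (⊕-∉ D {e ∷ []} λ { (here f≡e) → e≢f (sym f≡e) })))
    pointwise : ∀ f → into (toggle D e) f + 𝟙 (e ≟ f) * into D f ≡ into D f + 𝟙 (e ≟ f) * outof f
    pointwise f = split f (e ≟ f)

  -- Each reversal moves one unit from the head of the arc to its tail, and the contributions
  -- telescope along the walk.
  indeg-⊕ : ∀ {D s t es} → Walk G D s t es → Unique es → ∀ v →
            indeg G (D ⊕ es) v + 𝟙 (t ≟ v) ≡ indeg G D v + 𝟙 (s ≟ v)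
  indeg-⊕ nil _ v = refl
  indeg-⊕ {D} {t = t} {es = e ∷ es} (cons e refl w) (e∉ ∷ u) v = combine (indeg G (toggle (D ⊕ es) e) v) (indeg G (D ⊕ es) v) (indeg G D v)
    (subst₂ (λ h u → indeg G (toggle (D ⊕ es) e) v + 𝟙 (h ≟ v) ≡ indeg G (D ⊕ es) v + 𝟙 (u ≟ v))
      (sym (head-cong D (D ⊕ es) same)) (sym (tail-cong D (D ⊕ es) same)) (indeg-toggle (D ⊕ es) e v))
    (indeg-⊕ w u v)
    where
    -- When `e` is toggled it still has its direction in `D`, as it does not occur in `es`.
    same : D e ≡ (D ⊕ es) e
    same = ⊕-∉ D λ e∈ → All.lookup e∉ e∈ refl
    combine : ∀ a b c {h s t} → a + h ≡ b + s → b + t ≡ c + h → a + t ≡ c + s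
    combine a b c {h} {s} {t} p q = +-cancelʳ-≡ h (a + t) (c + s) (begin
      a + t + h    ≡⟨ xy∙z≈xz∙y a t h ⟩
      a + h + t    ≡⟨ cong (_+ t) p ⟩
      b + s + t    ≡⟨ xy∙z≈xz∙y b s t ⟩
      b + t + s    ≡⟨ cong (_+ s) q ⟩
      c + h + s    ≡⟨ xy∙z≈xz∙y c h s ⟩
      c + s + h    ∎)
      where
      open ≡-Reasoning

  -- In-degree sums over node sets, and strong connectivity.

  sum-cut : ∀ {C : Pred Node 0ℓ} (C? : Decidable C) D →
            sum (λ v → 𝟙 (C? v) * indeg G D v) ≡ sum (λ e → 𝟙 (C? (head G D e)))
  sum-cut C? D = begin
    sum (λ v → 𝟙 (C? v) * indeg G D v)                          ≡⟨ sum-cong-≗ (λ v → trans (cong (𝟙 (C? v) *_) (indeg-sum D v)) (*-distribˡ-sum (𝟙 (C? v)) (λ e → 𝟙 (head G D e ≟ v)))) ⟩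
    sum (λ v → sum (λ e → 𝟙 (C? v) * 𝟙 (head G D e ≟ v)))       ≡⟨ ∑-comm (λ v e → 𝟙 (C? v) * 𝟙 (head G D e ≟ v)) ⟩
    sum (λ e → sum (λ v → 𝟙 (C? v) * 𝟙 (head G D e ≟ v)))       ≡⟨ sum-cong-≗ (λ e → trans (sum-cong-≗ (λ v → *-comm (𝟙 (C? v)) _)) (sum-δ (head G D e) (𝟙 ∘ C?))) ⟩
    sum (λ e → 𝟙 (C? (head G D e)))                             ∎
    where
    open ≡-Reasoning
    *-distribˡ-sum : ∀ {k} c (f : Fin k → ℕ) → c * sum f ≡ sum (λ i → c * f i)
    *-distribˡ-sum {zero}  c f = *-zeroʳ c
    *-distribˡ-sum {suc k} c f = trans (*-distribˡ-+ c (f zero) _) (cong (c * f zero +_) (*-distribˡ-sum c (f ∘ suc)))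

  strong⇒reach : ∀ {D} → StronglyConnected G D → ∀ s t → Reach D U s t
  strong⇒reach sc s t = let es , w , _ = sc s t in es , w , All.universal (λ _ → tt) es

  reach⇒strong : ∀ {D} → (∀ s t → Reach D U s t) → StronglyConnected G D
  reach⇒strong r s t = let es , path , _ = reach⇒path (r s t) in es , path

  rev-strong : ∀ {D} → StronglyConnected G D → StronglyConnected G (rev D)
  rev-strong {D} sc = reach⇒strong λ s t → let _ , w , ps = strong⇒reach sc t s in
    reach-map-reverse w (All.map (λ {e} → reach-opp D (rev D) (rev-opp D {e})) ps)

  -- The part of the walk before `e`, run backwards together with `e`'s predecessors, leads to `s`;
  -- the part after `e`, run backwards, leads from `t` to the head of `e`.
  reach-reversed-arc : ∀ {D D′ Q s t es e} → Walk G D s t es →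
    All (λ e → Reach D′ Q (head G D e) (tail G D e)) es → e ∈ es →
    Reach D′ Q (tail G D e) s × Reach D′ Q t (head G D e)
  reach-reversed-arc (cons e refl w) (r ∷ rs) (here refl) = reach-refl , reach-map-reverse w rs
  reach-reversed-arc (cons e refl w) (r ∷ rs) (there f∈)  =
    let r₁ , r₂ = reach-reversed-arc w rs f∈ in reach-trans r₁ r , r₂

  -- The ends of a reversed arc stay connected through the other path.
  ⊕-strong : ∀ {D s t es fs} → StronglyConnected G D → Walk G D s t es → Unique es →
             Walk G D s t fs → (∀ e → e ∈ es → e ∉ fs) → StronglyConnected G (D ⊕ es)
  ⊕-strong {D} {s} {t} {es} {fs} sc w u w′ disj = reach⇒strong λ a b →
    let _ , v , _ = sc a b in reach-map v (All.universal arc _)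
    where
    reversed : All (λ e → Reach (D ⊕ es) U (head G D e) (tail G D e)) es
    reversed = All.tabulate λ e∈ → reach-opp D (D ⊕ es) (⊕-∈ D u e∈) tt
    s⇝t : Reach (D ⊕ es) U s t
    s⇝t = reach-map w′ (All.tabulate λ {e} e∈ → reach-same D (D ⊕ es) (⊕-∉ D {es} λ e∈es → disj e e∈es e∈) tt)
    arc : ∀ e → Reach (D ⊕ es) U (tail G D e) (head G D e)
    arc e with e ∈? es
    ... | yes e∈ = let r₁ , r₂ = reach-reversed-arc w reversed e∈ in reach-trans r₁ (reach-trans s⇝t r₂)
    ... | no  e∉ = reach-same D (D ⊕ es) (⊕-∉ D e∉) tt

  -- If `t` were unreachable, let `C` be the set reached from `s`. An arc with head in `C` under
  -- `D′` has its head in `C` under `D` too: if the orientations differ on it, its tail under `D` is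
  -- in `C` and the arc may be followed. So the in-degree sum over `C` is no larger for `D′`,
  -- although `s` gains and no node of `C` loses.
  excess-indeg⇒reach : ∀ {D D′ s t} → (∀ v → v ≢ t → indeg G D v ≤ indeg G D′ v) → indeg G D s < indeg G D′ s →
                       Reach D (λ e → D e ≢ D′ e) s t
  excess-indeg⇒reach {D} {D′} {s} {t} D≤D′ Ds<D′s with reach? {D = D} (λ e → ¬? (D e Bool.≟ D′ e)) s t
  ... | yes r = r
  ... | no ¬r = contradiction (≤-trans (≤-reflexive (sum-cut C? D′)) (≤-trans cut (≤-reflexive (sym (sum-cut C? D))))) (<⇒≱ bigger)
    where
    C? = reach? {D = D} (λ e → ¬? (D e Bool.≟ D′ e)) s
    closed : ∀ e → Reach D (λ e → D e ≢ D′ e) s (head G D′ e) → Reach D (λ e → D e ≢ D′ e) s (head G D e)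
    closed e r with D e Bool.≟ D′ e
    ... | yes eq = subst (Reach D _ s) (sym (head-cong D D′ eq)) r
    ... | no neq = reach-trans (subst (Reach D _ s) (sym (tail-opp D D′ neq)) r) (reach-arc e neq)
    cut : sum (λ e → 𝟙 (C? (head G D′ e))) ≤ sum (λ e → 𝟙 (C? (head G D e)))
    cut = sum-mono-≤ λ e → 𝟙-mono (C? (head G D′ e)) (C? (head G D e)) (closed e)
    pointwise : ∀ v → 𝟙 (C? v) * indeg G D v ≤ 𝟙 (C? v) * indeg G D′ v
    pointwise v with C? v
    ... | yes r = *-monoʳ-≤ 1 (D≤D′ v λ { refl → ¬r r })
    ... | no _  = z≤n
    bigger : sum (λ v → 𝟙 (C? v) * indeg G D v) < sum (λ v → 𝟙 (C? v) * indeg G D′ v)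
    bigger = sum-mono-< pointwise s (subst (λ k → k * indeg G D s < k * indeg G D′ s)
      (sym (𝟙-yes (C? s) reach-refl)) (*-monoʳ-< 1 Ds<D′s))

  -- Menger's theorem for two arc-disjoint paths.

  module _ {D : Orientation G} {C : Pred Node 0ℓ} where

    walk-exits : Decidable C → ∀ {s t es} → Walk G D s t es → C s → ¬ C t →
                 ∃[ e ] (e ∈ es × C (tail G D e) × ¬ C (head G D e))
    walk-exits C? nil cs ¬ct = contradiction cs ¬ct
    walk-exits C? (cons e refl w) cs ¬ct with C? (head G D e)
    ... | no ¬ch = e , here refl , cs , ¬ch
    ... | yes ch = let f , f∈ , rest = walk-exits C? w ch ¬ct in f , there f∈ , rest

    NeverEnters : List Arc → Set
    NeverEnters es = ∀ e → e ∈ es → C (head G D e) → C (tail G D e)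

    starts-inside : ∀ {s t es e} → Walk G D s t es → NeverEnters es → e ∈ es → C (tail G D e) → C s
    starts-inside (cons e refl w) ne (here refl) c = c
    starts-inside (cons e refl w) ne (there f∈)  c = ne e (here refl) (starts-inside w (λ g → ne g ∘ there) f∈ c)

    -- Between two exits the walk would have to re-enter `C`.
    exits-once : ∀ {s t es e f} → Walk G D s t es → NeverEnters es →
                 e ∈ es → C (tail G D e) → ¬ C (head G D e) →
                 f ∈ es → C (tail G D f) → ¬ C (head G D f) → e ≡ f
    exits-once w ne (here refl) _ _ (here refl) _ _ = refl
    exits-once (cons e refl w) ne (here refl) _ ¬c (there f∈) c _ =
      contradiction (starts-inside w (λ g → ne g ∘ there) f∈ c) ¬c
    exits-once (cons e refl w) ne (there f∈) c _ (here refl) _ ¬c =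
      contradiction (starts-inside w (λ g → ne g ∘ there) f∈ c) ¬c
    exits-once (cons e refl w) ne (there e∈) c ¬c (there f∈) c′ ¬c′ =
      exits-once w (λ g → ne g ∘ there) e∈ c ¬c f∈ c′ ¬c′

  -- The cut form of two arc-disjoint paths: no single arc separates `s` from `t`.
  TwoReach : Orientation G → Node → Node → Set
  TwoReach D s t = ∀ a → Reach D (a ≢_) s t

  -- If no augmenting walk existed, the set of nodes reachable from s after
  -- reversing es would be left by a single arc of D, which lies on es.
  augment : ∀ {D s t es} → Walk G D s t es → Unique es → TwoReach D s t → Reach (D ⊕ es) U s t
  augment {D} {s} {t} {es} w u two with reach? {D = D ⊕ es} U? s t
  ... | yes r = r
  ... | no ¬r =
    let a , a∈ , a-in , a-out = walk-exits C? w reach-refl ¬r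
        _ , w′ , a∉ = two a
        f , f∈ , f-in , f-out = walk-exits C? w′ reach-refl ¬r
    in contradiction (exits-once {C = Reach (D ⊕ es) U s} w never-enters a∈ a-in a-out (exit∈ f f-in f-out) f-in f-out) (All.lookup a∉ f∈)
    where
    C? = reach? {D = D ⊕ es} U? s
    never-enters : NeverEnters {D} {Reach (D ⊕ es) U s} es
    never-enters e e∈ r = reach-trans r (reach-opp D (D ⊕ es) (⊕-∈ D u e∈) tt)
    exit∈ : ∀ f → Reach (D ⊕ es) U s (tail G D f) → ¬ Reach (D ⊕ es) U s (head G D f) → f ∈ es
    exit∈ f f-in f-out with f ∈? es
    ... | yes f∈ = f∈
    ... | no  f∉ = contradiction (reach-trans f-in (reach-same D (D ⊕ es) (⊕-∉ D f∉) tt)) f-out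

  -- In its in-degrees, `D′` looks like `D` after reversing `k` arc-disjoint paths from `s` to `t`.
  -- Both sides carry a summand to avoid subtraction.
  ShiftedBy : ℕ → Node → Node → Orientation G → Orientation G → Set
  ShiftedBy k s t D D′ = ∀ v → indeg G D′ v + k * 𝟙 (t ≟ v) ≡ indeg G D v + k * 𝟙 (s ≟ v)

  shifted⇒reach : ∀ k {s t D D′} → s ≢ t → ShiftedBy (suc k) s t D D′ → Reach D (λ e → D e ≢ D′ e) s t
  shifted⇒reach k {s} {t} {D} {D′} s≢t shift = excess-indeg⇒reach
    (λ v v≢t → subst (indeg G D v ≤_) (sym (off-t v v≢t)) (m≤m+n _ _))
    (subst (indeg G D s <_) (sym (trans (off-t s s≢t) (cong (λ i → indeg G D s + suc k * i) (𝟙-yes (s ≟ s) refl))))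
      (m<m+n _ (s≤s z≤n)))
    where
    off-t : ∀ v → v ≢ t → indeg G D′ v ≡ indeg G D v + suc k * 𝟙 (s ≟ v)
    off-t v v≢t = begin
      indeg G D′ v                       ≡⟨ +-identityʳ _ ⟨
      indeg G D′ v + 0                   ≡⟨ cong (indeg G D′ v +_) (*-zeroʳ (suc k)) ⟨
      indeg G D′ v + suc k * 0           ≡⟨ cong (λ i → indeg G D′ v + suc k * i) (𝟙-no (t ≟ v) (≢-sym v≢t)) ⟨
      indeg G D′ v + suc k * 𝟙 (t ≟ v)   ≡⟨ shift v ⟩
      indeg G D v + suc k * 𝟙 (s ≟ v)    ∎
      where open ≡-Reasoning

  shifted-⊕ : ∀ k {s t D D′ es} → ShiftedBy (suc k) s t D D′ → Walk G D s t es → Unique es →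
              ShiftedBy k s t (D ⊕ es) D′
  shifted-⊕ k {s} {t} {D} {D′} {es} shift w u v =
    subtract (indeg G D v) (indeg G (D ⊕ es) v) (indeg G D′ v) (𝟙 (s ≟ v)) (𝟙 (t ≟ v)) (shift v) (indeg-⊕ w u v)
    where
    subtract : ∀ x y z σ τ → z + suc k * τ ≡ x + suc k * σ → y + τ ≡ x + σ → z + k * τ ≡ y + k * σ
    subtract x y z σ τ p q = +-cancelʳ-≡ τ _ _ (begin
      z + k * τ + τ     ≡⟨ pull z k τ ⟩
      z + suc k * τ     ≡⟨ p ⟩
      x + suc k * σ     ≡⟨ pull x k σ ⟨
      x + k * σ + σ     ≡⟨ xy∙z≈xz∙y x (k * σ) σ ⟩
      x + σ + k * σ     ≡⟨ cong (_+ k * σ) q ⟨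
      y + τ + k * σ     ≡⟨ xy∙z≈xz∙y y τ (k * σ) ⟩
      y + k * σ + τ     ∎)
      where
      open ≡-Reasoning
      pull : ∀ x k σ → x + k * σ + σ ≡ x + suc k * σ
      pull = solve-∀

  -- Both walks use arcs on which the current orientation differs from `D′`. Reversing the first
  -- path makes its arcs agree with `D′`, so the second walk avoids them and therefore already
  -- exists in `D`.
  shifted⇒disjoint-paths : ∀ {s t D D′} → s ≢ t → ShiftedBy 2 s t D D′ → TwoArcDisjointPaths G D s t
  shifted⇒disjoint-paths {s} {t} {D} {D′} s≢t shift with reach⇒path (shifted⇒reach 1 s≢t shift)
  ... | es , (w , u) , differ with shifted⇒reach 0 s≢t (shifted-⊕ 1 {D = D} {D′} shift w (path-arcs-unique w u))
  ...   | fs , w′ , differ′ =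
    let gs , path , gs∉ = reach⇒path (reach-map {Q = _∉ es} w′ (All.map back differ′))
    in es , gs , (w , u) , path , λ e e∈es e∈gs → All.lookup gs∉ e∈gs e∈es
    where
    back : ∀ {e} → (D ⊕ es) e ≢ D′ e → Reach D (_∉ es) (tail G (D ⊕ es) e) (head G (D ⊕ es) e)
    back {e} neq = reach-same (D ⊕ es) D (sym (⊕-∉ D e∉)) e∉
      where
      e∉ : e ∉ es
      e∉ e∈ = neq (trans (Bool.¬-not (≢-sym (⊕-∈ D (path-arcs-unique w u) e∈)))
                         (sym (Bool.¬-not (≢-sym (All.lookup differ e∈)))))

  -- The augmenting path may run back along `ps`. Instead of recombining the two, only the
  -- in-degrees after both reversals are kept: they are shifted by two, which yields disjoint paths.
  -- The hypothesis `Reach D U s t` covers graphs without arcs, where `TwoReach` is vacuous.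
  menger₂ : ∀ {D s t} → s ≢ t → Reach D U s t → TwoReach D s t → TwoArcDisjointPaths G D s t
  menger₂ {D} {s} {t} s≢t r two with reach⇒path r
  ... | ps , (w , u) , _ with reach⇒path (augment w (path-arcs-unique w u) two)
  ...   | qs , (w′ , u′) , _ = shifted⇒disjoint-paths s≢t λ v →
    add (indeg G D v) (indeg G (D ⊕ ps) v) (indeg G (D ⊕ ps ⊕ qs) v) (𝟙 (s ≟ v)) (𝟙 (t ≟ v))
      (indeg-⊕ w (path-arcs-unique w u) v) (indeg-⊕ w′ (path-arcs-unique w′ u′) v)
    where
    add : ∀ x y z σ τ → y + τ ≡ x + σ → z + τ ≡ y + σ → z + 2 * τ ≡ x + 2 * σ
    add x y z σ τ p q = begin
      z + 2 * τ      ≡⟨ double z τ ⟩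
      z + τ + τ      ≡⟨ cong (_+ τ) q ⟩
      y + σ + τ      ≡⟨ xy∙z≈xz∙y y σ τ ⟩
      y + τ + σ      ≡⟨ cong (_+ σ) p ⟩
      x + σ + σ      ≡⟨ double x σ ⟨
      x + 2 * σ      ∎
      where
      open ≡-Reasoning
      double : ∀ x σ → x + 2 * σ ≡ x + σ + σ
      double = solve-∀

  -- Minimality of `D` would equate all excess sums of `D` and `D ⊕ es`, but those at the new
  -- in-degree of `t` differ.
  disjoint-paths⇒not-decmin : ∀ {D s t} → StronglyConnected G D → indeg G D s + 2 ≤ indeg G D t →
                              TwoArcDisjointPaths G D s t → ¬ DecMinSC G D
  disjoint-paths⇒not-decmin {D} {s} {t} sc s+2≤t (es , fs , (w , u) , (w′ , _) , disj) min =
    T.transfer-≢ s+2≤t (≼∧≥lex⇒≡ {D ⊕ es} {D} (T.transfer-≤ s<t) (min (D ⊕ es) strong) (indeg G (D ⊕ es) t))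
    where
    arcs-unique = path-arcs-unique w u
    strong = ⊕-strong sc w arcs-unique w′ disj
    s<t : indeg G D s < indeg G D t
    s<t = ≤-trans (≤-reflexive (+-comm 1 _)) (≤-trans (+-monoʳ-≤ _ (n≤1+n 1)) s+2≤t)
    s≢t : s ≢ t
    s≢t refl = <-irrefl refl s<t
    module T = Transfer (indeg G D) (indeg G (D ⊕ es)) s≢t (indeg-⊕ w arcs-unique)

  -- Counting the arcs that leave classes.

  Guarded : Orientation G → (Node → Label (m G)) → Set
  Guarded D z = ∀ e {a} → z (tail G D e) ≡ just a → z (head G D e) ≢ just a → a ≡ e

  guarded-prune : ∀ D z w → Guarded D z → Guarded D (prune z w)
  guarded-prune D z w guarded e tail≡ head≢ =
    let z≡ , u , zu , wu = prune-just⁻ z w tail≡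
    in guarded e z≡ λ z≡′ → head≢ (prune-just⁺ z w z≡′ zu wu)

  used : (Node → Label (m G)) → Arc → ℕ
  used z a = 𝟙 (any? λ v → z v ≟ᴸ just a)

  leaving : Orientation G → (Node → Label (m G)) → Arc → ℕ
  leaving D z e = leaves (z (tail G D e)) (z (head G D e))

  -- Classes are named after the only arc that may leave them, so a leaving arc is itself a name in
  -- use.
  leaving≤used : ∀ D {z} → Guarded D z → ∀ e → leaving D z e ≤ used z e
  leaving≤used D {z} guarded e = go (z (tail G D e)) (z (head G D e)) refl refl
    where
    used-e : ∀ {a} → z (tail G D e) ≡ just a → a ≡ e → 1 ≤ used z e
    used-e eq refl = ≤-reflexive (sym (𝟙-yes (any? λ v → z v ≟ᴸ just e) (_ , eq)))
    go : ∀ x y → z (tail G D e) ≡ x → z (head G D e) ≡ y → leaves x y ≤ used z e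
    go nothing  _        _  _  = z≤n
    go (just a) nothing  tl hd = used-e tl (guarded e tl λ hd′ → contradiction (trans (sym hd) hd′) λ ())
    go (just a) (just b) tl hd with a ≟ b
    ... | yes _  = z≤n
    ... | no a≢b = used-e tl (guarded e tl λ hd′ → a≢b (just-injective (trans (sym hd′) hd)))

  -- Every nonempty class misses `t`, so a walk to `t` leaves it. Each leaving arc is charged only
  -- to the class of its tail, hence at most once after the sums are exchanged.
  used≤leaving : ∀ {D} → StronglyConnected G D → ∀ {z t} → z t ≡ nothing → sum (used z) ≤ sum (leaving D z)
  used≤leaving {D} sc {z} {t} zt = begin
    sum (used z)                        ≤⟨ sum-mono-≤ at-label ⟩
    sum (λ a → sum (λ e → share a e))   ≡⟨ ∑-comm share ⟩
    sum (λ e → sum (λ a → share a e))   ≤⟨ sum-mono-≤ at-arc ⟩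
    sum (leaving D z)                   ∎
    where
    open ≤-Reasoning
    share : Arc → Arc → ℕ
    share a e = 𝟙 (z (tail G D e) ≟ᴸ just a) * leaving D z e
    at-label : ∀ a → used z a ≤ sum (share a)
    at-label a with any? (λ v → z v ≟ᴸ just a)
    ... | no _ = z≤n
    ... | yes (v , zv) =
      let e , _ , in-class , out = walk-exits (λ v → z v ≟ᴸ just a) (proj₁ (proj₂ (sc v t))) zv
                                     λ zt′ → contradiction (trans (sym zt) zt′) λ ()
      in ≤-trans (*-mono-≤ (≤-reflexive (sym (𝟙-yes (z (tail G D e) ≟ᴸ just a) in-class))) (leaves-≢ in-class out))
                 (term≤sum (share a) e)
    sum-label : ∀ x k → sum (λ a → 𝟙 (x ≟ᴸ just a) * k) ≤ k
    sum-label nothing k = begin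
      sum (λ a → 𝟙 (nothing ≟ᴸ just {A = Arc} a) * k)   ≡⟨ sum-replicate-zero (m G) ⟩
      0                                                 ≤⟨ z≤n ⟩
      k                                                 ∎
    sum-label (just b) k = ≤-reflexive (trans
      (sum-cong-≗ λ a → cong (_* k) (𝟙-cong (just b ≟ᴸ just a) (b ≟ a) just-injective (cong just)))
      (sum-δ b (λ _ → k)))
    at-arc : ∀ e → sum (λ a → share a e) ≤ leaving D z e
    at-arc e = sum-label (z (tail G D e)) (leaving D z e)

  -- Uncrossing the two families of classes.

  module Uncross {D D′ : Orientation G} (sc : StronglyConnected G D) (sc′ : StronglyConnected G D′)
    {z w : Node → Label (m G)} {t : Node} (zt : z t ≡ nothing) (wt : w t ≡ nothing)
    (z-guarded : Guarded D z) (w-guarded : Guarded (rev D′) w)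
    (z-private : ∀ {v a} → z v ≡ just a → ∃[ u ] (z u ≡ just a × w u ≡ nothing))
    (w-private : ∀ {v a} → w v ≡ just a → ∃[ u ] (w u ≡ just a × z u ≡ nothing)) where

    private
      z° w° : Node → Label (m G)
      z° v = pure (w v) (z v)
      w° v = pure (z v) (w v)

      used-pure : ∀ (x y : Node → Label (m G)) → (∀ {v a} → x v ≡ just a → ∃[ u ] (x u ≡ just a × y u ≡ nothing)) →
                  ∀ a → used x a ≤ used (λ v → pure (y v) (x v)) a
      used-pure x y private-node a = 𝟙-mono (any? λ v → x v ≟ᴸ just a) (any? λ v → pure (y v) (x v) ≟ᴸ just a)
        λ (v , xv) → let u , xu , yu = private-node xv in u , trans (cong (λ l → pure l (x u)) yu) xu

      free : Node → ℕ
      free v = 𝟙 (free? (z v) (w v))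

      per-arc : ∀ e → free (head G D e) + (leaving D′ z° e + leaving (rev D) w° e) ≤
                      free (head G D′ e) + (leaving D z e + leaving (rev D′) w e)
      per-arc e
        rewrite sym (tail-opp D (rev D) {e} (rev-opp D)) | sym (head-opp D (rev D) {e} (rev-opp D))
              | sym (tail-opp D′ (rev D′) {e} (rev-opp D′)) | sym (head-opp D′ (rev D′) {e} (rev-opp D′))
        with D e Bool.≟ D′ e
      ... | yes eq rewrite sym (tail-cong D D′ eq) | sym (head-cong D D′ eq) =
        uncross-same (z (tail G D e)) (z (head G D e)) (w (tail G D e)) (w (head G D e))
      ... | no neq rewrite sym (tail-opp D D′ neq) | sym (head-opp D D′ neq) =
        uncross-opp (z (tail G D e)) (z (head G D e)) (w (tail G D e)) (w (head G D e))

    -- Each class of `z` has at most one exit in `D`, and its nonempty part in `z°` has an exit in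
    -- `D′`; the reversed orientations give the same for `w`. With these two bounds the leaving
    -- terms cancel from the sum of `per-arc`.
    free-indeg-≤ : sum (λ v → free v * indeg G D v) ≤ sum (λ v → free v * indeg G D′ v)
    free-indeg-≤ = subst₂ _≤_ (sym (sum-cut (λ v → free? (z v) (w v)) D)) (sym (sum-cut (λ v → free? (z v) (w v)) D′))
      (+-cancelʳ-≤ (sum (leaving D′ z°) + sum (leaving (rev D) w°)) _ _ (begin
        sum (free ∘ head G D) + (sum (leaving D′ z°) + sum (leaving (rev D) w°))
          ≡⟨ sum-+ (free ∘ head G D) (leaving D′ z°) (leaving (rev D) w°) ⟨
        sum (λ e → free (head G D e) + (leaving D′ z° e + leaving (rev D) w° e))
          ≤⟨ sum-mono-≤ per-arc ⟩
        sum (λ e → free (head G D′ e) + (leaving D z e + leaving (rev D′) w e))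
          ≡⟨ sum-+ (free ∘ head G D′) (leaving D z) (leaving (rev D′) w) ⟩
        sum (free ∘ head G D′) + (sum (leaving D z) + sum (leaving (rev D′) w))
          ≤⟨ +-monoʳ-≤ (sum (free ∘ head G D′)) (+-mono-≤ z-bound w-bound) ⟩
        sum (free ∘ head G D′) + (sum (leaving D′ z°) + sum (leaving (rev D) w°))
          ∎))
      where
      open ≤-Reasoning
      sum-+ : ∀ {k} (f g h : Fin k → ℕ) → sum (λ i → f i + (g i + h i)) ≡ sum f + (sum g + sum h)
      sum-+ f g h = trans (∑-distrib-+ f _) (cong (sum f +_) (∑-distrib-+ g h))
      z-bound : sum (leaving D z) ≤ sum (leaving D′ z°)
      z-bound = ≤-trans (sum-mono-≤ λ e → ≤-trans (leaving≤used D z-guarded e) (used-pure z w z-private e))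
        (used≤leaving sc′ {z°} {t} (cong₂ pure wt zt))
      w-bound : sum (leaving (rev D′) w) ≤ sum (leaving (rev D) w°)
      w-bound = ≤-trans (sum-mono-≤ λ e → ≤-trans (leaving≤used (rev D′) w-guarded e) (used-pure w z w-private e))
        (used≤leaving (rev-strong sc) {w°} {t} (cong₂ pure zt wt))

  -- Classes given by the last common arc of all walks to the target.

  record Labelling (D : Orientation G) (t : Node) : Set where
    field
      label          : Node → Label (m G)
      label-target   : label t ≡ nothing
      label-guarded  : Guarded D label
      label-nothing⁻ : ∀ {v} → label v ≡ nothing → TwoReach D v t

  module LastCut {D : Orientation G} (sc : StronglyConnected G D) (t : Node) where

    private
      avoids? : ∀ a v → Dec (Reach D (a ≢_) v t)
      avoids? a v = reach? (λ e → ¬? (a ≟ e)) v t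

    Cuts : Node → Arc → Set
    Cuts v a = ¬ Reach D (a ≢_) v t

    IsLastCut : Node → Arc → Set
    IsLastCut v a = Cuts v a × TwoReach D (head G D a) t

    walk-after : ∀ {P : Pred Arc 0ℓ} {u es a} → Walk G D u t es → All P es → a ∈ es → Reach D P (head G D a) t
    walk-after (cons e _ w) (_ ∷ ps) (here refl) = _ , w , ps
    walk-after (cons e _ w) (_ ∷ ps) (there a∈)  = walk-after w ps a∈

    ∉⇒avoids : ∀ {u es a} → Walk G D u t es → a ∉ es → Reach D (a ≢_) u t
    ∉⇒avoids w a∉ = _ , w , All.tabulate λ e∈ → λ { refl → a∉ e∈ }

    -- Every walk from `v` to `t` passes `a`, and from the head of `a` it must still pass `b`.
    cuts-trans : ∀ {v a b} → Cuts v a → Cuts (head G D a) b → Cuts v b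
    cuts-trans {a = a} v≁a a≁b (es , w , ps) with a ∈? es
    ... | yes a∈ = a≁b (walk-after w ps a∈)
    ... | no  a∉ = v≁a (∉⇒avoids w a∉)

    last-satisfying : ∀ {Q : Pred Arc 0ℓ} (Q? : Decidable Q) {u es} → Walk G D u t es → Any Q es →
                      ∃[ b ] (Q b × ∃[ fs ] (Walk G D (head G D b) t fs × ¬ Any Q fs))
    last-satisfying Q? (cons {es = es} e _ w) q with Any.any? Q? es
    ... | yes q′ = last-satisfying Q? w q′
    ... | no ¬q with q
    ...   | here qe  = e , qe , es , w , ¬q
    ...   | there q′ = contradiction q′ ¬q

    -- On a fixed walk to `t`, take the last arc that cuts off `v`. An arc cutting off its head
    -- would cut off `v` as well and lie later on the walk.
    lastCut-exists : ∀ {v a} → Cuts v a → ∃ (IsLastCut v)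
    lastCut-exists {v} {a} cut with sc v t
    ... | es , w , _ with a ∈? es
    ...   | no  a∉ = contradiction (∉⇒avoids w a∉) cut
    ...   | yes a∈ with last-satisfying (λ b → ¬? (avoids? b v)) w (Any.map (λ { refl → cut }) a∈)
    ...     | b , cut-b , fs , w′ , none = b , cut-b , two
      where
      two : TwoReach D (head G D b) t
      two c with avoids? c (head G D b)
      ... | yes r = r
      ... | no ¬r = ∉⇒avoids w′ λ c∈ → none (Any.map (λ { refl → cuts-trans cut-b ¬r }) c∈)

    -- Follow a walk to `t` until it first meets `a` or `b`. After crossing that arc, the other one
    -- can be avoided, so it is not a cut.
    lastCut-unique : ∀ {v a b} → IsLastCut v a → IsLastCut v b → a ≡ b
    lastCut-unique {v} {a} {b} (cut-a , two-a) (cut-b , two-b) with a ≟ b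
    ... | yes a≡b = a≡b
    ... | no a≢b with avoid-one (proj₁ (proj₂ (sc v t)))
      where
      avoid-one : ∀ {u es} → Walk G D u t es → Reach D (a ≢_) u t ⊎ Reach D (b ≢_) u t
      avoid-one nil = inj₁ reach-refl
      avoid-one (cons e refl w) with a ≟ e | b ≟ e
      ... | yes refl | _        = inj₂ (reach-trans (reach-arc e (≢-sym a≢b)) (two-a b))
      ... | no _     | yes refl = inj₁ (reach-trans (reach-arc e a≢b) (two-b a))
      ... | no a≢e   | no b≢e with avoid-one w
      ...   | inj₁ r = inj₁ (reach-trans (reach-arc e a≢e) r)
      ...   | inj₂ r = inj₂ (reach-trans (reach-arc e b≢e) r)
    ...   | inj₁ r = contradiction r cut-a
    ...   | inj₂ r = contradiction r cut-b

    lastCut? : ∀ v a → Dec (IsLastCut v a)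
    lastCut? v a = ¬? (avoids? a v) ×-dec all? (λ b → avoids? b (head G D a))

    label : Node → Label (m G)
    label v with any? (lastCut? v)
    ... | yes (a , _) = just a
    ... | no _        = nothing

    label-just⁻ : ∀ {v a} → label v ≡ just a → IsLastCut v a
    label-just⁻ {v} eq with any? (lastCut? v) | eq
    ... | yes (a , cut) | refl = cut

    label-just⁺ : ∀ {v a} → IsLastCut v a → label v ≡ just a
    label-just⁺ {v} cut with any? (lastCut? v)
    ... | yes (b , cut′) = cong just (lastCut-unique cut′ cut)
    ... | no ¬cut        = contradiction (_ , cut) ¬cut

    label-nothing⁻ : ∀ {v} → label v ≡ nothing → TwoReach D v t
    label-nothing⁻ {v} eq a with any? (lastCut? v) | avoids? a v
    ... | _       | yes r = r
    ... | no ¬cut | no ¬r = contradiction (lastCut-exists ¬r) ¬cut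

    label-target : label t ≡ nothing
    label-target with any? (lastCut? t)
    ... | yes (_ , cut , _) = contradiction reach-refl cut
    ... | no _              = refl

    -- If `e` is not `a`, the head of `e` cannot avoid `a` either, since otherwise the tail could do
    -- so through `e`. The head then has the same last cut.
    label-guarded : Guarded D label
    label-guarded e {a} tail≡ head≢ with a ≟ e | label-just⁻ tail≡
    ... | yes a≡e | _           = a≡e
    ... | no a≢e  | cut , two-a = contradiction
      (label-just⁺ ((λ r → cut (reach-trans (reach-arc e a≢e) r)) , two-a)) head≢

    labelling : Labelling D t
    labelling = record
      { label          = label
      ; label-target   = label-target
      ; label-guarded  = label-guarded
      ; label-nothing⁻ = label-nothing⁻
      }

  -- The exchange property.

  module _ {D D′ : Orientation G} (sc : StronglyConnected G D) (sc′ : StronglyConnected G D′) {t : Node}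
    (Z : Labelling D t) (W : Labelling (rev D′) t) where

    private
      module Z = Labelling Z
      module W = Labelling W

      z w : Node → Label (m G)
      z = prune Z.label W.label
      -- Pruning against the already pruned `z` only removes labels, so the nodes witnessing `z`
      -- stay outside the classes of `w`.
      w = prune W.label z

      zt : z t ≡ nothing
      zt = prune-nothing⁺ Z.label W.label Z.label-target

      wt : w t ≡ nothing
      wt = prune-nothing⁺ W.label z W.label-target

      z-private : ∀ {v a} → z v ≡ just a → ∃[ u ] (z u ≡ just a × w u ≡ nothing)
      z-private zv = let _ , u , zu , wu = prune-just⁻ Z.label W.label zv in
        u , prune-just⁺ Z.label W.label zu zu wu , prune-nothing⁺ W.label z wu

      w-private : ∀ {v a} → w v ≡ just a → ∃[ u ] (w u ≡ just a × z u ≡ nothing)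
      w-private wv = let _ , u , wu , zu = prune-just⁻ W.label z wv in
        u , prune-just⁺ W.label z wu wu zu , zu

      open Uncross sc sc′ zt wt
        (guarded-prune D Z.label W.label Z.label-guarded) (guarded-prune (rev D′) W.label z W.label-guarded)
        z-private w-private

    -- The free nodes lose nothing in total when passing from `D` to `D′`, but the free node `t`
    -- loses, so another one gains.
    exchange′ : indeg G D′ t < indeg G D t →
                ∃[ s ] (indeg G D s < indeg G D′ s × TwoReach D s t × TwoReach D′ t s)
    exchange′ t-drops with any? (λ s → free? (z s) (w s) ×-dec (indeg G D s <? indeg G D′ s))
    ... | yes (s , (zs , ws) , s-grows) =
      -- The prunings are undone in reverse order: `w` was pruned against `z`, and `z` against the
      -- original labels of `W`.
      let w-free = prune-nothing⁻ W.label z {s} ws zs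
          z-free = prune-nothing⁻ Z.label W.label {s} zs w-free
      in s , s-grows , Z.label-nothing⁻ z-free , λ a → reach-rev (W.label-nothing⁻ w-free a)
    ... | no ¬s = contradiction free-indeg-≤ (<⇒≱ (sum-mono-< pointwise t at-t))
      where
      pointwise : ∀ v → 𝟙 (free? (z v) (w v)) * indeg G D′ v ≤ 𝟙 (free? (z v) (w v)) * indeg G D v
      pointwise v = bound (free? (z v) (w v)) λ free → ≮⇒≥ λ v-grows → ¬s (v , free , v-grows)
        where
        bound : ∀ {F : Set} (f? : Dec F) {x y} → (F → x ≤ y) → 𝟙 f? * x ≤ 𝟙 f? * y
        bound (yes f) x≤y = *-monoʳ-≤ 1 (x≤y f)
        bound (no _)  _   = z≤n
      at-t : 𝟙 (free? (z t) (w t)) * indeg G D′ t < 𝟙 (free? (z t) (w t)) * indeg G D t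
      at-t = subst (λ k → k * indeg G D′ t < k * indeg G D t)
        (sym (𝟙-yes (free? (z t) (w t)) (zt , wt))) (*-monoʳ-< 1 t-drops)

  exchange : ∀ {D D′ t} → StronglyConnected G D → StronglyConnected G D′ → indeg G D′ t < indeg G D t →
             ∃[ s ] (indeg G D s < indeg G D′ s × TwoReach D s t × TwoReach D′ t s)
  exchange {t = t} sc sc′ = exchange′ sc sc′ (LastCut.labelling sc t) (LastCut.labelling (rev-strong sc′) t)

  -- Descent towards the given orientation.

  distance : Orientation G → Orientation G → ℕ
  distance D D′ = sum (λ v → indeg G D v ∸ indeg G D′ v)

  approach : ∀ {D D′ s t} → StronglyConnected G D′ → TwoArcDisjointPaths G D′ t s →
             indeg G D s < indeg G D′ s → indeg G D′ t < indeg G D t → indeg G D t ≤ suc (indeg G D s) →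
             ∃[ D″ ] (StronglyConnected G D″ × distance D D″ < distance D D′ × D″ ≼ D′)
  approach {D} {D′} {s} {t} sc′ (es , fs , (w , u) , (w′ , _) , disj) s-grows t-drops close =
    D′ ⊕ es , ⊕-strong sc′ w es-unique w′ disj , closer ,
    T.transfer-≤ (≤-trans t-drops (≤-trans close s-grows))
    where
    es-unique = path-arcs-unique w u
    t≢s : t ≢ s
    t≢s refl = <-asym s-grows t-drops
    module T = Transfer (indeg G D′) (indeg G (D′ ⊕ es)) t≢s (indeg-⊕ w es-unique)
    pointwise : ∀ v → indeg G D v ∸ indeg G (D′ ⊕ es) v ≤ indeg G D v ∸ indeg G D′ v
    pointwise v = go (s ≟ v) (t ≟ v)
      where
      go : Dec (s ≡ v) → Dec (t ≡ v) → indeg G D v ∸ indeg G (D′ ⊕ es) v ≤ indeg G D v ∸ indeg G D′ v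
      -- The node `s` loses a unit, but its in-degree in `D′` exceeded the one in `D`, so the
      -- truncated difference stays zero.
      go (yes refl) _ = ≤-trans (≤-reflexive (m≤n⇒m∸n≡0 (s≤s⁻¹ (≤-trans s-grows (≤-reflexive T.transfer-t))))) z≤n
      go (no _) (yes refl) = ∸-monoʳ-≤ (indeg G D v) (≤-trans (n≤1+n _) (≤-reflexive (sym T.transfer-s)))
      go (no s≢v) (no t≢v) = ≤-reflexive (cong (indeg G D v ∸_) (T.transfer-other t≢v s≢v))
    closer : distance D (D′ ⊕ es) < distance D D′
    closer = sum-mono-< pointwise t (∸-monoʳ-< (≤-reflexive (sym T.transfer-s))
      (≤-trans (≤-reflexive T.transfer-s) t-drops))

  no-improvement⇒≼ : ∀ {D} → StronglyConnected G D →
    ¬ (∃[ s ] ∃[ t ] (indeg G D t ≥ indeg G D s + 2 × TwoArcDisjointPaths G D s t)) →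
    ∀ D′ → StronglyConnected G D′ → D ≼ D′
  -- The bound starts strictly above the distance, so the recursion cannot reach zero.
  no-improvement⇒≼ {D} sc stuck D′ sc′ = descend (suc (distance D D′)) D′ sc′ ≤-refl
    where
    step : ∀ D′ → StronglyConnected G D′ → ∃[ t ] (indeg G D′ t < indeg G D t) →
           ∃[ D″ ] (StronglyConnected G D″ × distance D D″ < distance D D′ × D″ ≼ D′)
    step D′ sc′ (t , t-drops) =
      let s , s-grows , two , two′ = exchange sc sc′ t-drops
          s≢t = λ s≡t → <-asym s-grows (subst (λ v → indeg G D′ v < indeg G D v) (sym s≡t) t-drops)
      in approach sc′ (menger₂ (≢-sym s≢t) (strong⇒reach sc′ t s) two′) s-grows t-drops
           -- A larger gap between `t` and `s` would make the two paths in `D` an excluded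
           -- configuration.
           (≮⇒≥ λ far → stuck (s , t , subst (_≤ indeg G D t) (+-comm 2 _) far , menger₂ s≢t (strong⇒reach sc s t) two))

    descend : ∀ k D′ → StronglyConnected G D′ → distance D D′ < k → D ≼ D′
    descend (suc k) D′ sc′ <k with any? (λ t → indeg G D′ t <? indeg G D t)
    -- Here the in-degrees of `D` are at most those of `D′` at every node.
    ... | no ¬t = λ c → sum-mono-≤ λ v → ∸-monoˡ-≤ c (≮⇒≥ λ v-drops → ¬t (v , v-drops))
    ... | yes t-drops =
      let D″ , sc″ , closer , D″≼D′ = step D′ sc′ t-drops
      in λ c → ≤-trans (descend k D″ sc″ (≤-trans closer (s≤s⁻¹ <k)) c) (D″≼D′ c)

theorem10p1 : (G : Graph) → (∃[ D₀ ] StronglyConnected G D₀) →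
    (D : Orientation G) → StronglyConnected G D →
    DecMinSC G D ⇔
    (¬ (∃[ s ] ∃[ t ] (indeg G D t ≥ indeg G D s + 2 × TwoArcDisjointPaths G D s t)))
theorem10p1 G _ D sc = mk⇔
  (λ min (s , t , s+2≤t , paths) → disjoint-paths⇒not-decmin G sc s+2≤t paths min)
  (λ stuck D′ sc′ → ≼⇒≤lex G {D} {D′} (no-improvement⇒≼ G sc stuck D′ sc′))
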